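{- For every graph $H$, every integer $t\ge 1$ and every real $\alpha>0$ there exists $C>0$ such that the following holds: every $H$-minor-free graph $G$ with $|E(G)|<(t-\alpha)|V(G)|$ contains a $t$-island of size at most $C$.
   Context: All graphs are finite and simple. $G$ is $H$-minor-free if $H$ is not a minor of $G$. For an integer $t$, a $t$-island in a graph $G$ is a non-empty set $S\subseteq V(G)$ such that every vertex of $S$ has fewer than $t$ neighbors in $V(G)\setminus S$. -}

module Defs where

open import Data.Nat using (ℕ; zero; suc; _+_; _<_)
open import Data.Bool using (Bool; true; false; _∧_; not; if_then_else_)
open import Data.Fin using (Fin) renaming (zero to fzero; suc to fsuc)
open import Data.Fin.Properties using (_<?_) renaming (_≟_ to _≟ᶠ_)
open import Data.Maybe using (Maybe; just; nothing)
open import Data.Product using (Σ; _×_; ∃)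
open import Relation.Nullary.Decidable using (isYes)
open import Relation.Binary.PropositionalEquality using (_≡_)

record Graph : Set where
  field
    n     : ℕ
    adj   : Fin n → Fin n → Bool
    sym   : ∀ u v → adj u v ≡ adj v u
    irrefl : ∀ v → adj v v ≡ false
open Graph public

count : ∀ {m} → (Fin m → Bool) → ℕ
count {zero}  P = 0
count {suc m} P = (if P fzero then 1 else 0) + count (λ i → P (fsuc i))

sumFin : ∀ {m} → (Fin m → ℕ) → ℕ
sumFin {zero}  f = 0
sumFin {suc m} f = f fzero + sumFin (λ i → f (fsuc i))

numVertices : Graph → ℕ
numVertices G = n G

numEdges : Graph → ℕ
numEdges G = sumFin (λ i → count (λ j → isYes (i <? j) ∧ adj G i j))

VSet : Graph → Set
VSet G = Fin (n G) → Bool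

data Reach (G : Graph) (P : VSet G) : Fin (n G) → Fin (n G) → Set where
  here : ∀ {u} → P u ≡ true → Reach G P u u
  step : ∀ {u w v} → P u ≡ true → adj G u w ≡ true → Reach G P w v → Reach G P u v

-- H is a minor of G: there are pairwise disjoint, non-empty branch sets
-- (encoded by φ : V(G) → Maybe V(H); branch set of h is φ⁻¹(just h)),
-- each inducing a connected subgraph of G, such that every edge hh' of H
-- is realised by an edge of G between the branch sets of h and h'.
branch : (H G : Graph) → (Fin (n G) → Maybe (Fin (n H))) → Fin (n H) → VSet G
branch H G φ h v with φ v
... | nothing = false
... | just h' = isYes (h ≟ᶠ h')

record MinorModel (H G : Graph) : Set where
  field
    φ         : Fin (n G) → Maybe (Fin (n H))
    nonempty  : ∀ h → ∃ λ v → branch H G φ h v ≡ true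
    connected : ∀ h u v → branch H G φ h u ≡ true → branch H G φ h v ≡ true
                → Reach G (branch H G φ h) u v
    edges     : ∀ h h' → adj H h h' ≡ true →
                Σ (Fin (n G)) λ u → Σ (Fin (n G)) λ v →
                  branch H G φ h u ≡ true × branch H G φ h' v ≡ true × adj G u v ≡ true

IsMinor : Graph → Graph → Set
IsMinor H G = MinorModel H G

outDeg : (G : Graph) → VSet G → Fin (n G) → ℕ
outDeg G S v = count (λ w → adj G v w ∧ not (S w))

IsIsland : ℕ → (G : Graph) → VSet G → Set
IsIsland t G S = (∃ λ v → S v ≡ true) × (∀ v → S v ≡ true → outDeg G S v < t)

module Submission where

-- Let e(P) be the number of edges meeting P.  If there is no t-island of size at most C, then
-- deleting vertices with at least t outside neighbours one at a time gives e(P) ≥ t|P| whenever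
-- |P| ≤ C.  If P = A ∪ B ∪ X with no edges between A and B, then e(P) ≥ e(A) + e(B), so such a cut
-- loses only t|X|.  Cutting along separators of size O(√|P|), scale by scale (|P| ≤ m⁴ for
-- m = J, J + 1, …), the total loss is O(t|V|/J), since the loss at scale m is O(1/m²) per vertex;
-- taking C = J⁴ with J large gives e(V) ≥ (t − α)|V|.
--
-- The separators come from a variant of the Alon–Seymour–Thomas argument.  Keep a region U and at
-- most |V(H)| connected, disjoint, pairwise adjacent branch sets with neighbours in U.  Either some
-- v ∈ U lies within distance d of all of them, and the union of short paths from v is a new branch
-- set, or some branch set can be enlarged to a ball that leaves a constant fraction of U and whose
-- outermost layer is sparse.  Stopping as soon as |U| ≤ |P|/2, U is not too small, and is separated
-- from the rest by the small parts of the branch sets that can still see U.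

open import Defs
open import Data.Bool using (Bool; true; false; _∧_; not; if_then_else_)
open import Data.Bool.Properties using () renaming (_≟_ to _≟ᵇ_)
open import Data.Empty using (⊥; ⊥-elim)
open import Data.Fin using (Fin) renaming (zero to fzero; suc to fsuc; _<_ to _<ᶠ_)
open import Data.Fin.Properties using (_<?_; any?; all?; <-cmp; ¬∀⟶∃¬) renaming (_≟_ to _≟ᶠ_; <-irrefl to <ᶠ-irrefl)
open import Data.Nat using (ℕ; NonZero; zero; suc; _+_; _*_; _≤_; _<_; _≤?_; z≤n; s≤s; s≤s⁻¹; >-nonZero; _≤′_; ≤′-refl; ≤′-step)
open import Data.Nat.Properties hiding (_<?_; <-cmp)
open import Algebra.Properties.CommutativeSemigroup +-commutativeSemigroup using () renaming (interchange to +-interchange)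
open import Data.Product using (Σ; ∃; _×_; _,_; proj₁; proj₂)
open import Data.Sum using (_⊎_; inj₁; inj₂; [_,_]′)
open import Function using (_∘_)
open import Relation.Binary.Definitions using (tri<; tri≈; tri>)
open import Relation.Binary.PropositionalEquality as ≡ using (_≡_; _≢_; refl; cong; subst; trans)
open import Relation.Nullary using (¬_; Dec; yes; no)
open import Relation.Nullary.Decidable using (isYes; toSum; _×-dec_; _⊎-dec_; _→-dec_; ¬?)
open import Data.Maybe using (Maybe; just; nothing)
open import Data.Nat.Tactic.RingSolver using (solve-∀)

-- Finite sets as Boolean predicates, and counting

private variable
  size : ℕ

FinSet : ℕ → Set
FinSet m = Fin m → Bool

infix 4 _∈_ _∉_ _∈?_ _⊆_

_∈_ _∉_ : Fin size → FinSet size → Set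
v ∈ S = S v ≡ true
v ∉ S = ¬ (v ∈ S)

_∈?_ : (v : Fin size) (S : FinSet size) → Dec (v ∈ S)
v ∈? S = S v ≟ᵇ true

_⊆_ : FinSet size → FinSet size → Set
S ⊆ S′ = ∀ v → v ∈ S → v ∈ S′

isYes⁺ : ∀ {A : Set} (d : Dec A) → A → isYes d ≡ true
isYes⁺ (yes _) _ = refl
isYes⁺ (no ¬a) a = ⊥-elim (¬a a)

isYes⁻ : ∀ {A : Set} (d : Dec A) → isYes d ≡ true → A
isYes⁻ (yes a) _ = a
isYes⁻ (no _) ()

∧⁺ : ∀ {a b} → a ≡ true → b ≡ true → a ∧ b ≡ true
∧⁺ refl refl = refl

∧⁻ : ∀ a {b} → a ∧ b ≡ true → a ≡ true × b ≡ true
∧⁻ true eq = refl , eq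

not⁻ : ∀ {a} → not a ≡ true → ¬ (a ≡ true)
not⁻ {false} _ ()

⟪_⟫ : {Q : Fin size → Set} → (∀ v → Dec (Q v)) → FinSet size
⟪ Q? ⟫ v = isYes (Q? v)

⟦_⟧ : Fin size → FinSet size
⟦ v ⟧ = ⟪ v ≟ᶠ_ ⟫

_∖_ : FinSet size → FinSet size → FinSet size
S ∖ S′ = ⟪ (λ v → (v ∈? S) ×-dec ¬? (v ∈? S′)) ⟫

∖⁺ : (S S′ : FinSet size) → ∀ {v} → v ∈ S → v ∉ S′ → v ∈ S ∖ S′
∖⁺ S S′ {v} a b = isYes⁺ ((v ∈? S) ×-dec ¬? (v ∈? S′)) (a , b)

∖⁻ : (S S′ : FinSet size) → ∀ {v} → v ∈ S ∖ S′ → v ∈ S × v ∉ S′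
∖⁻ S S′ {v} = isYes⁻ ((v ∈? S) ×-dec ¬? (v ∈? S′))

∖-split : (S S′ : FinSet size) → ∀ {v} → v ∈ S → v ∈ S′ ⊎ v ∈ S ∖ S′
∖-split S S′ {v} v∈S = [ inj₁ , (λ v∉S′ → inj₂ (∖⁺ S S′ v∈S v∉S′)) ]′ (toSum (v ∈? S′))

ind : Bool → ℕ
ind b = if b then 1 else 0

count-union : (R P Q : FinSet size) → (∀ v → v ∈ R → v ∈ P ⊎ v ∈ Q) →
              count R ≤ count P + count Q
count-union {zero} R P Q c = z≤n
count-union {suc m} R P Q c = begin
  ind (R fzero) + count (R ∘ fsuc)
    ≤⟨ +-mono-≤ (head (R fzero) (P fzero) (Q fzero) (c fzero))
                (count-union (R ∘ fsuc) (P ∘ fsuc) (Q ∘ fsuc) (c ∘ fsuc)) ⟩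
  (ind (P fzero) + ind (Q fzero)) + (count (P ∘ fsuc) + count (Q ∘ fsuc))
    ≡⟨ +-interchange (ind (P fzero)) (ind (Q fzero)) (count (P ∘ fsuc)) (count (Q ∘ fsuc)) ⟩
  count P + count Q ∎
  where
  open ≤-Reasoning
  head : ∀ r p q → (r ≡ true → p ≡ true ⊎ q ≡ true) → ind r ≤ ind p + ind q
  head false p q _ = z≤n
  head true p q f with f refl
  ... | inj₁ refl = s≤s z≤n
  ... | inj₂ refl = m≤n+m 1 (ind p)

count-disjoint : (P Q R : FinSet size) → P ⊆ R → Q ⊆ R → (∀ v → v ∈ P → v ∉ Q) →
                 count P + count Q ≤ count R
count-disjoint {zero} P Q R _ _ _ = z≤n
count-disjoint {suc m} P Q R p q d = begin
  count P + count Q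
    ≡⟨ +-interchange (ind (P fzero)) (count (P ∘ fsuc)) (ind (Q fzero)) (count (Q ∘ fsuc)) ⟩
  (ind (P fzero) + ind (Q fzero)) + (count (P ∘ fsuc) + count (Q ∘ fsuc))
    ≤⟨ +-mono-≤ (head (P fzero) (Q fzero) (R fzero) (p fzero) (q fzero) (d fzero))
                (count-disjoint (P ∘ fsuc) (Q ∘ fsuc) (R ∘ fsuc) (p ∘ fsuc) (q ∘ fsuc) (d ∘ fsuc)) ⟩
  count R ∎
  where
  open ≤-Reasoning
  head : ∀ p q r → (p ≡ true → r ≡ true) → (q ≡ true → r ≡ true) →
         (p ≡ true → ¬ (q ≡ true)) → ind p + ind q ≤ ind r
  head false false r f g d = z≤n
  head true true r f g d = ⊥-elim (d refl refl)
  head true false r f g d rewrite f refl = ≤-refl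
  head false true r f g d rewrite g refl = ≤-refl

count-∅ : ∀ m → count {m} (λ _ → false) ≡ 0
count-∅ zero = refl
count-∅ (suc m) = count-∅ m

count-mono : (P Q : FinSet size) → P ⊆ Q → count P ≤ count Q
count-mono {m} P Q f = begin
  count P                          ≤⟨ count-union P Q (λ _ → false) (λ v → inj₁ ∘ f v) ⟩
  count Q + count {m} (λ _ → false) ≡⟨ cong (count Q +_) (count-∅ m) ⟩
  count Q + 0                      ≡⟨ +-identityʳ _ ⟩
  count Q ∎
  where open ≤-Reasoning

count-pos : (P : FinSet size) → ∀ v → v ∈ P → 0 < count P
count-pos P fzero p rewrite p = s≤s z≤n
count-pos P (fsuc v) p = ≤-trans (count-pos (P ∘ fsuc) v p) (m≤n+m _ (ind (P fzero)))

count-witness : (P : FinSet size) → 0 < count P → ∃ λ v → v ∈ P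
count-witness {suc m} P p with P fzero in eq
... | true = fzero , eq
... | false with count-witness (P ∘ fsuc) p
...   | v , q = fsuc v , q

count-strict : (P Q : FinSet size) → P ⊆ Q → ∀ v → v ∉ P → v ∈ Q → count P < count Q
count-strict P Q f v v∉P v∈Q = ≤-trans
  (+-monoˡ-≤ (count P) (count-pos ⟦ v ⟧ v (isYes⁺ (v ≟ᶠ v) refl)))
  (count-disjoint ⟦ v ⟧ P Q
    (λ u u∈ → subst (_∈ Q) (isYes⁻ (v ≟ᶠ u) u∈) v∈Q) f
    (λ u u∈ u∈P → v∉P (subst (_∈ P) (≡.sym (isYes⁻ (v ≟ᶠ u) u∈)) u∈P)))

count-⟦⟧ : (v : Fin size) → count ⟦ v ⟧ ≤ 1
count-⟦⟧ {suc m} fzero = s≤s (≤-trans (count-mono (⟦ fzero {m} ⟧ ∘ fsuc) (λ _ → false) (λ { u () })) (≤-reflexive (count-∅ m)))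
count-⟦⟧ {suc m} (fsuc v) = ≤-trans
  (count-mono (⟦ fsuc v ⟧ ∘ fsuc) ⟦ v ⟧
    (λ u u∈ → isYes⁺ (v ≟ᶠ u) (fsuc-inj (isYes⁻ (fsuc v ≟ᶠ fsuc u) u∈))))
  (count-⟦⟧ v)
  where
  fsuc-inj : ∀ {u w : Fin m} → fsuc u ≡ fsuc w → u ≡ w
  fsuc-inj refl = refl

sumFin-mono : (f g : Fin size → ℕ) → (∀ i → f i ≤ g i) → sumFin f ≤ sumFin g
sumFin-mono {zero} f g h = z≤n
sumFin-mono {suc m} f g h = +-mono-≤ (h fzero) (sumFin-mono (f ∘ fsuc) (g ∘ fsuc) (h ∘ fsuc))

sumFin-+ : (f g : Fin size → ℕ) → sumFin (λ i → f i + g i) ≡ sumFin f + sumFin g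
sumFin-+ {zero} f g = refl
sumFin-+ {suc m} f g = trans
  (cong (f fzero + g fzero +_) (sumFin-+ (f ∘ fsuc) (g ∘ fsuc)))
  (+-interchange (f fzero) (g fzero) (sumFin (f ∘ fsuc)) (sumFin (g ∘ fsuc)))

sumFin-ind : (P : FinSet size) → sumFin (ind ∘ P) ≡ count P
sumFin-ind {zero} P = refl
sumFin-ind {suc m} P = cong (ind (P fzero) +_) (sumFin-ind (P ∘ fsuc))

sumFin-term : (f : Fin size → ℕ) → ∀ i → f i ≤ sumFin f
sumFin-term f fzero = m≤m+n _ _
sumFin-term f (fsuc i) = ≤-trans (sumFin-term (f ∘ fsuc) i) (m≤n+m _ _)

sumFin-bounded : (f : Fin size → ℕ) (b : ℕ) → (∀ i → f i ≤ b) → sumFin f ≤ size * b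
sumFin-bounded {zero} f b h = z≤n
sumFin-bounded {suc m} f b h = +-mono-≤ (h fzero) (sumFin-bounded (f ∘ fsuc) b (h ∘ fsuc))

-- A largest term is at least the average. The first argument guarantees that an index exists.
sumFin-max : Fin size → (f : Fin size → ℕ) → ∃ λ i → sumFin f ≤ size * f i
sumFin-max {suc zero} _ f = fzero , ≤-refl
sumFin-max {suc (suc m)} _ f with sumFin-max fzero (f ∘ fsuc)
... | i , p with ≤-total (f fzero) (f (fsuc i))
...   | inj₁ q = fsuc i , +-mono-≤ q p
...   | inj₂ q = fzero , +-monoʳ-≤ (f fzero) (≤-trans p (*-monoʳ-≤ (suc m) q))

count-cover : ∀ {k} (R : FinSet size) (Q : Fin k → FinSet size) →
              (∀ v → v ∈ R → ∃ λ i → v ∈ Q i) → count R ≤ sumFin (count ∘ Q)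
count-cover {m} {zero} R Q c = ≤-trans
  (count-mono R (λ _ → false) (λ v v∈ → ⊥-elim (no-index (proj₁ (c v v∈)))))
  (≤-reflexive (count-∅ m))
  where
  no-index : ¬ Fin 0
  no-index ()
count-cover {m} {suc k} R Q c = ≤-trans
  (count-union R (Q fzero) (R ∖ Q fzero) (λ v → ∖-split R (Q fzero)))
  (+-monoʳ-≤ (count (Q fzero)) (count-cover (R ∖ Q fzero) (Q ∘ fsuc) rest))
  where
  rest : ∀ v → v ∈ R ∖ Q fzero → ∃ λ i → v ∈ Q (fsuc i)
  rest v v∈ with ∖⁻ R (Q fzero) v∈
  ... | v∈R , ¬q with c v v∈R
  ...   | fzero , q = ⊥-elim (¬q q)
  ...   | fsuc i , q = i , q

-- Edges meeting a set

-- The condition `i <? j` files each edge under its smaller end, as in `numEdges`, so that `edgesAt`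
-- counts every edge meeting `P` exactly once.
touching : (G : Graph) → VSet G → Fin (n G) → VSet G
touching G P i = ⟪ (λ j → (i <? j) ×-dec (j ∈? adj G i) ×-dec ((i ∈? P) ⊎-dec (j ∈? P))) ⟫

edgesAt : (G : Graph) → VSet G → ℕ
edgesAt G P = sumFin (count ∘ touching G P)

module _ (G : Graph) where

  touching⁺ : ∀ P {i j} → i <ᶠ j → j ∈ adj G i → i ∈ P ⊎ j ∈ P → j ∈ touching G P i
  touching⁺ P {i} {j} a b c = isYes⁺ ((i <? j) ×-dec (j ∈? adj G i) ×-dec ((i ∈? P) ⊎-dec (j ∈? P))) (a , b , c)

  touching⁻ : ∀ P {i j} → j ∈ touching G P i → i <ᶠ j × j ∈ adj G i × (i ∈ P ⊎ j ∈ P)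
  touching⁻ P {i} {j} = isYes⁻ ((i <? j) ×-dec (j ∈? adj G i) ×-dec ((i ∈? P) ⊎-dec (j ∈? P)))

  edgesAt≤numEdges : ∀ P → edgesAt G P ≤ numEdges G
  edgesAt≤numEdges P = sumFin-mono _ _ λ i → count-mono (touching G P i) _ λ j j∈ →
    let i<j , ij , _ = touching⁻ P j∈ in ∧⁺ (isYes⁺ (i <? j) i<j) ij

  -- An edge meeting both `A` and `B` would either have an end in both or join one to the other, so
  -- no edge is counted twice on the left.
  edgesAt-disjoint : ∀ A B P → A ⊆ P → B ⊆ P → (∀ v → v ∈ A → v ∉ B) →
                     (∀ u v → u ∈ A → v ∈ B → v ∉ adj G u) →
                     edgesAt G A + edgesAt G B ≤ edgesAt G P
  edgesAt-disjoint A B P A⊆P B⊆P disj nonadj = begin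
    edgesAt G A + edgesAt G B
      ≡⟨ sumFin-+ (count ∘ touching G A) (count ∘ touching G B) ⟨
    sumFin (λ i → count (touching G A i) + count (touching G B i))
      ≤⟨ sumFin-mono _ _ (λ i → count-disjoint (touching G A i) (touching G B i) (touching G P i)
           (widen A⊆P i) (widen B⊆P i) (sep i)) ⟩
    edgesAt G P ∎
    where
    open ≤-Reasoning
    widen : ∀ {S} → S ⊆ P → ∀ i → touching G S i ⊆ touching G P i
    widen {S} S⊆P i j j∈ with touching⁻ S j∈
    ... | a , b , inj₁ c = touching⁺ P a b (inj₁ (S⊆P i c))
    ... | a , b , inj₂ c = touching⁺ P a b (inj₂ (S⊆P j c))
    sep : ∀ i j → j ∈ touching G A i → j ∉ touching G B i
    sep i j p q with touching⁻ A p | touching⁻ B q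
    ... | _ , _ , inj₁ iA | _ , _ , inj₁ iB = disj i iA iB
    ... | _ , e , inj₁ iA | _ , _ , inj₂ jB = nonadj i j iA jB e
    ... | _ , e , inj₂ jA | _ , _ , inj₁ iB = nonadj j i jA iB (trans (Graph.sym G j i) e)
    ... | _ , _ , inj₂ jA | _ , _ , inj₂ jB = disj j jA jB

  -- The edges from `v` to the outside of `P` meet `P` but not `P ∖ ⟦ v ⟧`. As edges are filed by
  -- smaller end, those to larger neighbours (`above`) all sit in row `v`, while those to smaller
  -- neighbours (`below`) are spread one per row.
  edgesAt-remove : ∀ P v → v ∈ P →
                   outDeg G P v + edgesAt G (P ∖ ⟦ v ⟧) ≤ edgesAt G P
  edgesAt-remove P v v∈P = begin
    outDeg G P v + edgesAt G P′
      ≤⟨ +-monoˡ-≤ _ (count-union _ above below split) ⟩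
    (count above + count below) + edgesAt G P′
      ≤⟨ +-monoˡ-≤ _ (+-mono-≤ own (≤-reflexive (≡.sym (sumFin-ind below)))) ⟩
    (sumFin gain + sumFin (ind ∘ below)) + edgesAt G P′
      ≡⟨ cong (_+ edgesAt G P′) (sumFin-+ gain (ind ∘ below)) ⟨
    sumFin (λ i → gain i + ind (below i)) + edgesAt G P′
      ≡⟨ sumFin-+ (λ i → gain i + ind (below i)) (count ∘ touching G P′) ⟨
    sumFin (λ i → gain i + ind (below i) + count (touching G P′ i))
      ≤⟨ sumFin-mono _ _ row ⟩
    edgesAt G P ∎
    where
    open ≤-Reasoning
    P′ = P ∖ ⟦ v ⟧
    above below : VSet G
    above = ⟪ (λ w → (v <? w) ×-dec (w ∈? adj G v) ×-dec ¬? (w ∈? P)) ⟫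
    below = ⟪ (λ w → (w <? v) ×-dec (w ∈? adj G v) ×-dec ¬? (w ∈? P)) ⟫
    above⁻ : ∀ {w} → w ∈ above → v <ᶠ w × w ∈ adj G v × w ∉ P
    above⁻ {w} = isYes⁻ ((v <? w) ×-dec (w ∈? adj G v) ×-dec ¬? (w ∈? P))
    below⁻ : ∀ {w} → w ∈ below → w <ᶠ v × w ∈ adj G v × w ∉ P
    below⁻ {w} = isYes⁻ ((w <? v) ×-dec (w ∈? adj G v) ×-dec ¬? (w ∈? P))
    split : ∀ w → adj G v w ∧ not (P w) ≡ true → w ∈ above ⊎ w ∈ below
    split w w∈ with ∧⁻ (adj G v w) w∈ | <-cmp v w
    ... | e , p | tri< lt _ _ = inj₁ (isYes⁺ ((v <? w) ×-dec (w ∈? adj G v) ×-dec ¬? (w ∈? P)) (lt , e , not⁻ p))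
    ... | e , p | tri> _ _ gt = inj₂ (isYes⁺ ((w <? v) ×-dec (w ∈? adj G v) ×-dec ¬? (w ∈? P)) (gt , e , not⁻ p))
    ... | e , p | tri≈ _ refl _ = ⊥-elim (not⁻ p v∈P)
    -- Charging all of `above` to row `v` lets the inequality be checked row by row.
    gain : Fin (n G) → ℕ
    gain i = if isYes (v ≟ᶠ i) then count above else 0
    own : count above ≤ sumFin gain
    own = ≤-trans (≤-reflexive (cong (λ b → if b then count above else 0)
                    (≡.sym (isYes⁺ (v ≟ᶠ v) refl)))) (sumFin-term gain v)
    widen : ∀ i → touching G P′ i ⊆ touching G P i
    widen i j j∈ with touching⁻ P′ j∈
    ... | a , b , inj₁ c = touching⁺ P a b (inj₁ (proj₁ (∖⁻ P ⟦ v ⟧ c)))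
    ... | a , b , inj₂ c = touching⁺ P a b (inj₂ (proj₁ (∖⁻ P ⟦ v ⟧ c)))
    v∉P′ : v ∉ P′
    v∉P′ p = proj₂ (∖⁻ P ⟦ v ⟧ p) (isYes⁺ (v ≟ᶠ v) refl)
    rowv : count above + count (touching G P′ v) ≤ count (touching G P v)
    rowv = count-disjoint above (touching G P′ v) (touching G P v)
      (λ w w∈ → let lt , e , _ = above⁻ w∈ in touching⁺ P lt e (inj₁ v∈P))
      (widen v) disj
      where
      disj : ∀ w → w ∈ above → w ∉ touching G P′ v
      disj w p q with touching⁻ P′ q
      ... | _ , _ , inj₁ c = v∉P′ c
      ... | _ , _ , inj₂ c = proj₂ (proj₂ (above⁻ p)) (proj₁ (∖⁻ P ⟦ v ⟧ c))
    rowb : ∀ i → i ∈ below → 1 + count (touching G P′ i) ≤ count (touching G P i)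
    rowb i p with below⁻ p
    ... | lt , e , i∉P = count-strict (touching G P′ i) (touching G P i) (widen i) v v∉
                           (touching⁺ P lt (trans (Graph.sym G i v) e) (inj₂ v∈P))
      where
      v∉ : v ∉ touching G P′ i
      v∉ q with touching⁻ P′ q
      ... | _ , _ , inj₁ c = i∉P (proj₁ (∖⁻ P ⟦ v ⟧ c))
      ... | _ , _ , inj₂ c = v∉P′ c
    row : ∀ i → gain i + ind (below i) + count (touching G P′ i) ≤ count (touching G P i)
    row i = by-cases (v ≟ᶠ i) (below i) refl
      where
      by-cases : (d : Dec (v ≡ i)) (b : Bool) → below i ≡ b →
                 (if isYes d then count above else 0) + ind b + count (touching G P′ i) ≤ count (touching G P i)
      by-cases (yes refl) false _ = ≤-trans (≤-reflexive (cong (_+ count (touching G P′ v)) (+-identityʳ _))) rowv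
      by-cases (yes refl) true eq = ⊥-elim (<ᶠ-irrefl refl (proj₁ (below⁻ eq)))
      by-cases (no _) false _ = count-mono (touching G P′ i) (touching G P i) (widen i)
      by-cases (no _) true eq = rowb i eq

  SmallIsland : ℕ → ℕ → Set
  SmallIsland t C = Σ (VSet G) λ S → IsIsland t G S × count S ≤ C

  -- Either `P` is itself an island, or some vertex of `P` has at least `t` outside neighbours;
  -- deleting it lowers the edge count by at least `t` and the size by one. The recursion runs on
  -- the size bound `b`.
  island-or-edges : ∀ t C b P → count P ≤ b → b ≤ C → SmallIsland t C ⊎ t * count P ≤ edgesAt G P
  island-or-edges t C b P P≤b b≤C with any? (_∈? P)
  ... | no empty = inj₂ (≤-trans (≤-reflexive (trans (cong (t *_) P≡0) (*-zeroʳ t))) z≤n)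
    where
    P≡0 : count P ≡ 0
    P≡0 = n≤0⇒n≡0 (≤-trans (count-mono P (λ _ → false) (λ v p → ⊥-elim (empty (v , p))))
                           (≤-reflexive (count-∅ (n G))))
  ... | yes (u , u∈P) with any? (λ v → (v ∈? P) ×-dec (t ≤? outDeg G P v))
  ...   | no none = inj₁ (P , ((u , u∈P) , λ v v∈P → ≰⇒> (λ t≤ → none (v , v∈P , t≤))) , ≤-trans P≤b b≤C)
  island-or-edges t C zero P P≤b b≤C | yes (u , u∈P) | yes _ =
    ⊥-elim (<⇒≱ (count-pos P u u∈P) P≤b)
  island-or-edges t C (suc b) P P≤b b≤C | yes _ | yes (v , v∈P , t≤) =
    [ inj₁ , (λ e → inj₂ (bound e)) ]′
      (island-or-edges t C b P′ (s≤s⁻¹ (≤-trans smaller P≤b)) (≤-trans (n≤1+n b) b≤C))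
    where
    open ≤-Reasoning
    P′ = P ∖ ⟦ v ⟧
    smaller : count P′ < count P
    smaller = count-strict P′ P (λ w w∈ → proj₁ (∖⁻ P ⟦ v ⟧ w∈)) v
                (λ v∈ → proj₂ (∖⁻ P ⟦ v ⟧ v∈) (isYes⁺ (v ≟ᶠ v) refl)) v∈P
    bound : t * count P′ ≤ edgesAt G P′ → t * count P ≤ edgesAt G P
    bound e = begin
      t * count P                  ≤⟨ *-monoʳ-≤ t (count-union P ⟦ v ⟧ P′ (λ w → ∖-split P ⟦ v ⟧)) ⟩
      t * (count ⟦ v ⟧ + count P′) ≤⟨ *-monoʳ-≤ t (+-monoˡ-≤ (count P′) (count-⟦⟧ v)) ⟩
      t * suc (count P′)           ≡⟨ *-suc t (count P′) ⟩
      t + t * count P′             ≤⟨ +-mono-≤ t≤ e ⟩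
      outDeg G P v + edgesAt G P′  ≤⟨ edgesAt-remove P v v∈P ⟩
      edgesAt G P ∎

-- Connectivity and balls

module _ (G : Graph) where

  Connected : VSet G → Set
  Connected S = ∀ u v → u ∈ S → v ∈ S → Reach G S u v

  adj-sym : ∀ {u v} → v ∈ adj G u → u ∈ adj G v
  adj-sym {u} {v} e = trans (Graph.sym G v u) e

  reach-mono : ∀ {S S′ u v} → S ⊆ S′ → Reach G S u v → Reach G S′ u v
  reach-mono S⊆ (here p) = here (S⊆ _ p)
  reach-mono S⊆ (step p e r) = step (S⊆ _ p) e (reach-mono S⊆ r)

  reach-trans : ∀ {S u v w} → Reach G S u v → Reach G S v w → Reach G S u w
  reach-trans (here _) r = r
  reach-trans (step p e r) r′ = step p e (reach-trans r r′)

  reach-source : ∀ {S u v} → Reach G S u v → u ∈ S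
  reach-source (here p) = p
  reach-source (step p _ _) = p

  reach-sym : ∀ {S u v} → Reach G S u v → Reach G S v u
  reach-sym (here p) = here p
  reach-sym (step p e r) = reach-trans (reach-sym r) (step (reach-source r) (adj-sym e) (here p))

  connected-extend : ∀ S S′ → S ⊆ S′ → Connected S →
                     (∀ v → v ∈ S′ → v ∈ S ⊎ ∃ λ w → w ∈ S × w ∈ adj G v) → Connected S′
  connected-extend S S′ S⊆ conn near u v u∈ v∈ with near u u∈ | near v v∈
  ... | inj₁ a | inj₁ b = reach-mono S⊆ (conn u v a b)
  ... | inj₁ a | inj₂ (y , b , e) = reach-trans (reach-mono S⊆ (conn u y a b)) (step (S⊆ y b) (adj-sym e) (here v∈))
  ... | inj₂ (x , a , e) | inj₁ b = step u∈ e (reach-mono S⊆ (conn x v a b))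
  ... | inj₂ (x , a , e) | inj₂ (y , b , e′) =
    step u∈ e (reach-trans (reach-mono S⊆ (conn x y a b)) (step (S⊆ y b) (adj-sym e′) (here v∈)))

  Ball-dec : ∀ (U B : VSet G) v → Dec (v ∈ B ⊎ (v ∈ U × ∃ λ w → w ∈ B × w ∈ adj G v))
  Ball-dec U B v = (v ∈? B) ⊎-dec ((v ∈? U) ×-dec any? (λ w → (w ∈? B) ×-dec (w ∈? adj G v)))

  grow : VSet G → VSet G → VSet G
  grow U B = ⟪ Ball-dec U B ⟫

  -- Growth enters `U` only: besides `M`, the ball holds the vertices of `U` joined to `M` by a path
  -- of at most `e` edges running through `U`.
  Ball : VSet G → VSet G → ℕ → VSet G
  Ball U M zero = M
  Ball U M (suc e) = grow U (Ball U M e)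

  module _ (U M : VSet G) where

    Ball-step : ∀ e → Ball U M e ⊆ Ball U M (suc e)
    Ball-step e v p = isYes⁺ (Ball-dec U (Ball U M e) v) (inj₁ p)

    Ball-neighbour : ∀ e {v w} → v ∈ U → w ∈ Ball U M e → w ∈ adj G v → v ∈ Ball U M (suc e)
    Ball-neighbour e {v} {w} v∈U w∈ vw = isYes⁺ (Ball-dec U (Ball U M e) v) (inj₂ (v∈U , w , w∈ , vw))

    Ball⁻ : ∀ e {v} → v ∈ Ball U M (suc e) → v ∈ Ball U M e ⊎ (v ∈ U × ∃ λ w → w ∈ Ball U M e × w ∈ adj G v)
    Ball⁻ e {v} = isYes⁻ (Ball-dec U (Ball U M e) v)

    Ball-mono : ∀ {e e′} → e ≤′ e′ → Ball U M e ⊆ Ball U M e′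
    Ball-mono ≤′-refl v p = p
    Ball-mono {e′ = suc e′} (≤′-step le) v p = Ball-step e′ v (Ball-mono le v p)

    Ball-⊆ : ∀ e v → v ∈ Ball U M e → v ∈ M ⊎ v ∈ U
    Ball-⊆ zero v p = inj₁ p
    Ball-⊆ (suc e) v p with Ball⁻ e p
    ... | inj₁ q = Ball-⊆ e v q
    ... | inj₂ (q , _) = inj₂ q

    Ball-connected : Connected M → ∀ e → Connected (Ball U M e)
    Ball-connected conn zero = conn
    Ball-connected conn (suc e) = connected-extend (Ball U M e) (Ball U M (suc e)) (Ball-step e)
      (Ball-connected conn e) near
      where
      near : ∀ v → v ∈ Ball U M (suc e) → v ∈ Ball U M e ⊎ ∃ λ w → w ∈ Ball U M e × w ∈ adj G v
      near v p with Ball⁻ e p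
      ... | inj₁ q = inj₁ q
      ... | inj₂ (_ , w) = inj₂ w

    -- Stands for a path in `U` from `v` to a neighbour of `M`. Reachability from `v` inside
    -- `carrier` replaces the path itself, so that several tentacles from one `v` unite to a
    -- connected set.
    record Tentacle (v : Fin (n G)) (e : ℕ) : Set where
      field
        carrier : VSet G
        inside  : carrier ⊆ U
        small   : count carrier ≤ e
        rooted  : ∀ w → w ∈ carrier → Reach G carrier v w
        tip     : ∃ λ x → x ∈ carrier × ∃ λ y → y ∈ M × y ∈ adj G x

    -- Walk from `v` to a neighbour one layer closer to `M` until `M` is adjacent. Each layer adds
    -- one vertex, and `v ∉ M` excludes radius 0.
    tentacle : ∀ e v → v ∈ U → v ∉ M → v ∈ Ball U M e → Tentacle v e
    tentacle zero v v∈U v∉M p = ⊥-elim (v∉M p)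
    tentacle (suc e) v v∈U v∉M p with Ball⁻ e p
    ... | inj₁ q = record
      { carrier = carrier ; inside = inside ; small = ≤-trans small (n≤1+n e) ; rooted = rooted ; tip = tip }
      where open Tentacle (tentacle e v v∈U v∉M q)
    ... | inj₂ (_ , w , w∈ , vw) with w ∈? M
    ...   | yes w∈M = record
      { carrier = ⟦ v ⟧
      ; inside = λ u u∈ → subst (_∈ U) (isYes⁻ (v ≟ᶠ u) u∈) v∈U
      ; small = ≤-trans (count-⟦⟧ v) (s≤s z≤n)
      ; rooted = λ u u∈ → subst (Reach G ⟦ v ⟧ v) (isYes⁻ (v ≟ᶠ u) u∈) (here v∈v)
      ; tip = v , v∈v , w , w∈M , vw
      }
      where
      v∈v : v ∈ ⟦ v ⟧
      v∈v = isYes⁺ (v ≟ᶠ v) refl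
    ...   | no w∉M = record
      { carrier = Q
      ; inside = λ u u∈ → [ (λ a → subst (_∈ U) (isYes⁻ (v ≟ᶠ u) a) v∈U) , inside u ]′ (Q⁻ u∈)
      ; small = ≤-trans (count-union Q ⟦ v ⟧ carrier (λ u → Q⁻)) (+-mono-≤ (count-⟦⟧ v) small)
      ; rooted = λ u u∈ → [ (λ a → subst (Reach G Q v) (isYes⁻ (v ≟ᶠ u) a) (here v∈Q))
                          , (λ a → step v∈Q vw (reach-mono carrier⊆Q (rooted u a))) ]′ (Q⁻ u∈)
      ; tip = let x , x∈ , y = tip in x , carrier⊆Q x x∈ , y
      }
      where
      w∈U : w ∈ U
      w∈U = [ ⊥-elim ∘ w∉M , (λ a → a) ]′ (Ball-⊆ e w w∈)
      open Tentacle (tentacle e w w∈U w∉M w∈)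
      Q? : ∀ u → Dec (u ∈ ⟦ v ⟧ ⊎ u ∈ carrier)
      Q? u = (u ∈? ⟦ v ⟧) ⊎-dec (u ∈? carrier)
      Q : VSet G
      Q = ⟪ Q? ⟫
      Q⁻ : ∀ {u} → u ∈ Q → u ∈ ⟦ v ⟧ ⊎ u ∈ carrier
      Q⁻ {u} = isYes⁻ (Q? u)
      carrier⊆Q : carrier ⊆ Q
      carrier⊆Q u a = isYes⁺ (Q? u) (inj₂ a)
      v∈Q : v ∈ Q
      v∈Q = isYes⁺ (Q? v) (inj₁ (isYes⁺ (v ≟ᶠ v) refl))

-- If all `d` increments exceeded `s`, the total growth would be at least `d * suc s`.
flat-step : ∀ (b : ℕ → ℕ) d s → b d < b 0 + d * suc s → ∃ λ e → e < d × b (suc e) ≤ b e + s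
flat-step b zero s lt = ⊥-elim (<-irrefl (≡.sym (+-identityʳ (b 0))) lt)
flat-step b (suc d) s lt with b (suc d) ≤? b d + s
... | yes flat = d , n<1+n d , flat
... | no steep with flat-step b d s (+-cancelʳ-< (suc s) (b d) (b 0 + d * suc s) (begin-strict
    b d + suc s               ≡⟨ +-suc (b d) s ⟩
    suc (b d + s)             ≤⟨ ≰⇒> steep ⟩
    b (suc d)                 <⟨ lt ⟩
    b 0 + (suc s + d * suc s) ≡⟨ cong (b 0 +_) (+-comm (suc s) (d * suc s)) ⟩
    b 0 + (d * suc s + suc s) ≡⟨ +-assoc (b 0) (d * suc s) (suc s) ⟨
    b 0 + d * suc s + suc s   ∎))
  where open ≤-Reasoning
...   | e , e<d , flat = e , ≤-trans e<d (n≤1+n d) , flat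

-- Separators

put : ∀ {A : Set} → Fin size → A → (Fin size → A) → Fin size → A
put z x f j = if isYes (z ≟ᶠ j) then x else f j

put-elim : ∀ {A : Set} (Q : Fin size → A → Set) z x f → Q z x → (∀ j → z ≢ j → Q j (f j)) →
           ∀ j → Q j (put z x f j)
put-elim Q z x f q r j with z ≟ᶠ j
... | yes refl = q
... | no z≢j = r j z≢j

module _ (G : Graph) where

  Live : VSet G → VSet G → Set
  Live U M = ∃ λ u → u ∈ U × ∃ λ w → w ∈ M × w ∈ adj G u

  live? : ∀ U M → Dec (Live U M)
  live? U M = any? λ u → (u ∈? U) ×-dec any? λ w → (w ∈? M) ×-dec (w ∈? adj G u)

  live-mono : ∀ {U U′} M → U′ ⊆ U → Live U′ M → Live U M
  live-mono M U′⊆U (u , u∈ , r) = u , U′⊆U u u∈ , r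

  Touch : VSet G → VSet G → Set
  Touch M M′ = (∀ v → v ∈ M → v ∉ M′) × ∃ λ u → u ∈ M × ∃ λ v → v ∈ M′ × v ∈ adj G u

  touch-sym : ∀ {M M′} → Touch M M′ → Touch M′ M
  touch-sym (d , u , u∈ , v , v∈ , e) = (λ w a b → d w b a) , v , v∈ , u , u∈ , adj-sym G e

module _ (H G : Graph) (P : VSet G) (s d : ℕ) where

  -- M i are the current branch sets, X i the part of M i that may be adjacent to U.  Only slots
  -- whose branch set still has a neighbour in U count; the others are free to be overwritten.
  record State (U : VSet G) : Set where
    field
      U⊆P      : U ⊆ P
      M X      : Fin (n H) → VSet G
      conn     : ∀ i → Connected G (M i)
      apart    : ∀ i v → v ∈ M i → v ∉ U
      touch    : ∀ i j → i ≢ j → Live G U (M i) → Live G U (M j) → Touch G (M i) (M j)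
      X⊆M      : ∀ i → X i ⊆ M i
      X-small  : ∀ i → count (X i) ≤ s
      boundary : ∀ u w → u ∈ U → w ∈ P → w ∉ U → w ∈ adj G u → ∃ λ i → w ∈ X i

  -- `half` bounds `A` from above. `large` bounds `A` from below by a constant fraction of `P`, up
  -- to the term in `s`, and so keeps `B` well below `P`.
  record Separation : Set where
    field
      A B    : VSet G
      A⊆P    : A ⊆ P
      B⊆P    : B ⊆ P
      disj   : ∀ v → v ∈ A → v ∉ B
      nonadj : ∀ u v → u ∈ A → v ∈ B → v ∉ adj G u
      cover  : count P ≤ (count A + count B) + n H * s
      half   : 2 * count A ≤ count P
      large  : count P ≤ 2 * (suc (n H) * count A) + 2 * s

  -- Empty branch sets are never live, so `touch` is vacuous, and `U = P` has no neighbours in `P`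
  -- outside itself.
  initial : State P
  initial = record
    { U⊆P = λ v p → p
    ; M = λ _ _ → false
    ; X = λ _ _ → false
    ; conn = λ { i u v () }
    ; apart = λ { i v () }
    ; touch = λ { i j _ (_ , _ , _ , () , _) }
    ; X⊆M = λ { i v () }
    ; X-small = λ i → ≤-trans (≤-reflexive (count-∅ (n G))) z≤n
    ; boundary = λ u w _ w∈P w∉P → ⊥-elim (w∉P w∈P)
    }

  module _ {U : VSet G} (σ : State U) where
    open State σ

    -- Shrinking `U` can only make slots dead, so among the conditions in `touch` only the pairs
    -- with the new set in slot `z` have to be checked. The old `X z` is lost, hence the new
    -- boundary must be covered by `X′` and the other slots.
    replace : ∀ z (U′ M′ X′ : VSet G) → U′ ⊆ U → Connected G M′ → (∀ v → v ∈ M′ → v ∉ U′) →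
              (∀ j → z ≢ j → Live G U (M j) → Live G U′ M′ → Touch G (M j) M′) →
              X′ ⊆ M′ → count X′ ≤ s →
              (∀ u w → u ∈ U′ → w ∈ P → w ∉ U′ → w ∈ adj G u → w ∈ X′ ⊎ ∃ λ i → z ≢ i × w ∈ X i) →
              State U′
    replace z U′ M′ X′ U′⊆U conn′ apart′ touch′ X′⊆M′ X′-small boundary′ = record
      { U⊆P = λ v p → U⊆P v (U′⊆U v p)
      ; M = put z M′ M
      ; X = put z X′ X
      ; conn = put-elim (λ _ S → Connected G S) z M′ M conn′ (λ j _ → conn j)
      ; apart = put-elim (λ _ S → ∀ v → v ∈ S → v ∉ U′) z M′ M apart′
                  (λ j _ v p q → apart j v p (U′⊆U v q))
      ; touch = put-elim (λ i S → ∀ j → i ≢ j → Live G U′ S → Live G U′ (put z M′ M j) → Touch G S (put z M′ M j)) z M′ M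
          (put-elim (λ j S → z ≢ j → Live G U′ M′ → Live G U′ S → Touch G M′ S) z M′ M
            (λ z≢z → ⊥-elim (z≢z refl))
            (λ j z≢j _ l l′ → touch-sym G (touch′ j z≢j (live-mono G (M j) U′⊆U l′) l)))
          (λ i z≢i → put-elim (λ j S → i ≢ j → Live G U′ (M i) → Live G U′ S → Touch G (M i) S) z M′ M
            (λ _ l l′ → touch′ i z≢i (live-mono G (M i) U′⊆U l) l′)
            (λ j _ i≢j l l′ → touch i j i≢j (live-mono G (M i) U′⊆U l) (live-mono G (M j) U′⊆U l′)))
      ; X⊆M = X⊆M′
      ; X-small = put-elim (λ _ S → count S ≤ s) z X′ X X′-small (λ j _ → X-small j)
      ; boundary = λ u w a b c e → found w (boundary′ u w a b c e)
      }
      where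
      X⊆M′ : ∀ i → put z X′ X i ⊆ put z M′ M i
      X⊆M′ i with z ≟ᶠ i
      ... | yes _ = X′⊆M′
      ... | no _ = X⊆M i
      put-eq : put z X′ X z ≡ X′
      put-eq with z ≟ᶠ z
      ... | yes _ = refl
      ... | no z≢z = ⊥-elim (z≢z refl)
      put-neq : ∀ i → z ≢ i → put z X′ X i ≡ X i
      put-neq i z≢i with z ≟ᶠ i
      ... | yes z≡i = ⊥-elim (z≢i z≡i)
      ... | no _ = refl
      found : ∀ w → w ∈ X′ ⊎ (∃ λ i → z ≢ i × w ∈ X i) → ∃ λ i → w ∈ put z X′ X i
      found w (inj₁ p) = z , subst (w ∈_) (≡.sym put-eq) p
      found w (inj₂ (i , z≢i , p)) = i , subst (w ∈_) (≡.sym (put-neq i z≢i)) p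

    -- Live slots are non-empty, connected, pairwise disjoint and pairwise adjacent. If all are live
    -- they form a model of the complete graph on the vertices of `H`, which contains `H`.
    model : (∀ i → Live G U (M i)) → MinorModel H G
    model live = record
      { φ = φ
      ; nonempty = λ h → let _ , _ , w , w∈ , _ = live h in w , M⊆branch h w w∈
      ; connected = λ h u v u∈ v∈ → reach-mono G (M⊆branch h)
                      (conn h u v (branch⊆M h u u∈) (branch⊆M h v v∈))
      ; edges = edges
      }
      where
      first : ∀ {v} → Dec (∃ λ h → v ∈ M h) → Maybe (Fin (n H))
      first (yes (h , _)) = just h
      first (no _) = nothing
      φ : Fin (n G) → Maybe (Fin (n H))
      φ v = first (any? (λ h → v ∈? M h))
      unique : ∀ h h′ v → v ∈ M h → v ∈ M h′ → h ≡ h′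
      unique h h′ v a b with h ≟ᶠ h′
      ... | yes eq = eq
      ... | no neq = ⊥-elim (proj₁ (touch h h′ neq (live h) (live h′)) v a b)
      M⊆branch : ∀ h → M h ⊆ branch H G φ h
      M⊆branch h v p with any? (λ h → v ∈? M h)
      ... | yes (h′ , q) = isYes⁺ (h ≟ᶠ h′) (unique h h′ v p q)
      ... | no none = ⊥-elim (none (h , p))
      branch⊆M : ∀ h → branch H G φ h ⊆ M h
      branch⊆M h v p with any? (λ h → v ∈? M h)
      ... | yes (h′ , q) = subst (λ i → v ∈ M i) (≡.sym (isYes⁻ (h ≟ᶠ h′) p)) q
      branch⊆M h v () | no _
      edges : ∀ h h′ → adj H h h′ ≡ true → Σ (Fin (n G)) λ u → Σ (Fin (n G)) λ v →
              branch H G φ h u ≡ true × branch H G φ h′ v ≡ true × adj G u v ≡ true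
      edges h h′ e with h ≟ᶠ h′
      ... | yes refl = ⊥-elim (absurd (trans (≡.sym e) (irrefl H h)))
        where
        absurd : true ≢ false
        absurd ()
      ... | no h≢h′ = let _ , u , u∈ , v , v∈ , uv = touch h h′ h≢h′ (live h) (live h′)
                      in u , v , M⊆branch h u u∈ , M⊆branch h′ v v∈ , uv

    -- By `boundary`, every neighbour of `U` in `P` outside `U` lies in some `X i`; deleting all
    -- `X i` cuts `U` off from the rest of `P`.
    separation : 2 * count U ≤ count P → count P ≤ 2 * (suc (n H) * count U) + 2 * s → Separation
    separation half large = record
      { A = U ; B = B ; A⊆P = U⊆P ; B⊆P = λ v p → proj₁ (B⁻ p)
      ; disj = λ v a b → proj₁ (proj₂ (B⁻ b)) a
      ; nonadj = λ u v a b e → proj₂ (proj₂ (B⁻ b)) (boundary u v a (proj₁ (B⁻ b)) (proj₁ (proj₂ (B⁻ b))) e)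
      ; cover = cover
      ; half = half ; large = large
      }
      where
      open ≤-Reasoning
      B? : ∀ v → Dec (v ∈ P × v ∉ U × ¬ ∃ λ i → v ∈ X i)
      B? v = (v ∈? P) ×-dec ¬? (v ∈? U) ×-dec ¬? (any? λ i → v ∈? X i)
      B X∪ : VSet G
      B = ⟪ B? ⟫
      X∪ = ⟪ (λ v → any? λ i → v ∈? X i) ⟫
      B⁻ : ∀ {v} → v ∈ B → v ∈ P × v ∉ U × ¬ ∃ λ i → v ∈ X i
      B⁻ {v} = isYes⁻ (B? v)
      outside : ∀ v → v ∈ P ∖ U → v ∈ B ⊎ v ∈ X∪
      outside v p = by-cases (any? λ i → v ∈? X i)
        where
        by-cases : Dec (∃ λ i → v ∈ X i) → v ∈ B ⊎ v ∈ X∪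
        by-cases (yes q) = inj₂ (isYes⁺ (any? λ i → v ∈? X i) q)
        by-cases (no ¬q) = let v∈P , v∉U = ∖⁻ P U p in inj₁ (isYes⁺ (B? v) (v∈P , v∉U , ¬q))
      cover : count P ≤ (count U + count B) + n H * s
      cover = begin
        count P
          ≤⟨ count-union P U (P ∖ U) (λ v → ∖-split P U) ⟩
        count U + count (P ∖ U)
          ≤⟨ +-monoʳ-≤ (count U) (count-union (P ∖ U) B X∪ outside) ⟩
        count U + (count B + count X∪)
          ≡⟨ +-assoc (count U) (count B) (count X∪) ⟨
        (count U + count B) + count X∪
          ≤⟨ +-monoʳ-≤ (count U + count B) (count-cover X∪ X (λ v → isYes⁻ (any? λ i → v ∈? X i))) ⟩
        (count U + count B) + sumFin (count ∘ X)
          ≤⟨ +-monoʳ-≤ (count U + count B) (sumFin-bounded (count ∘ X) s X-small) ⟩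
        (count U + count B) + n H * s ∎

    -- The last component says that one step does not shrink `U` too much: growing a branch set
    -- keeps a constant fraction, adding one removes at most `s` vertices. This prevents
    -- overshooting when the search stops.
    Progress : Set
    Progress = Σ (VSet G) λ U′ → State U′ × count U′ < count U ×
               (count U ≤ suc (n H) * count U′ ⊎ count U ≤ count U′ + s)

    -- The new branch set `T` is `v` with a tentacle to each live branch set. It has at most
    -- `1 + n H * d` vertices, so it can serve as its own `X`.
    add-branch-set : suc (n H * d) ≤ s → ∀ z → ¬ Live G U (M z) → ∀ v → v ∈ U →
                     (∀ i → Live G U (M i) → v ∈ Ball G U (M i) d) → Progress
    add-branch-set hd≤s z dead v v∈U central =
        U ∖ T
      , replace z (U ∖ T) T T (λ u p → proj₁ (∖⁻ U T p)) T-conn (λ u p q → proj₂ (∖⁻ U T q) p)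
          T-touch (λ u p → p) (≤-trans T-size hd≤s) bd
      , count-strict (U ∖ T) U (λ u p → proj₁ (∖⁻ U T p)) v (λ p → proj₂ (∖⁻ U T p) v∈T) v∈U
      , inj₂ (≤-trans (count-union U (U ∖ T) T (λ u p → [ inj₂ , inj₁ ]′ (∖-split U T p)))
                      (+-monoʳ-≤ (count (U ∖ T)) (≤-trans T-size hd≤s)))
      where
      Arm : Fin (n H) → Set
      Arm i = Σ (VSet G) λ Q → Q ⊆ U × count Q ≤ d × (∀ w → w ∈ Q → Reach G Q v w) ×
              (Live G U (M i) → ∃ λ x → x ∈ Q × ∃ λ y → y ∈ M i × y ∈ adj G x)
      arm : ∀ i → Arm i
      arm i with live? G U (M i)
      ... | yes l = let t = tentacle G U (M i) d v v∈U (λ p → apart i v p v∈U) (central i l)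
                        open Tentacle t
                    in carrier , inside , small , rooted , λ _ → tip
      -- A dead slot need not be touched and gets the empty arm.
      ... | no ¬l = (λ _ → false) , (λ _ ()) , ≤-trans (≤-reflexive (count-∅ (n G))) z≤n , (λ _ ()) , (λ l → ⊥-elim (¬l l))
      Q : Fin (n H) → VSet G
      Q i = proj₁ (arm i)
      T? : ∀ u → Dec (u ∈ ⟦ v ⟧ ⊎ ∃ λ i → u ∈ Q i)
      T? u = (u ∈? ⟦ v ⟧) ⊎-dec any? λ i → u ∈? Q i
      T : VSet G
      T = ⟪ T? ⟫
      Q⊆T : ∀ i → Q i ⊆ T
      Q⊆T i u p = isYes⁺ (T? u) (inj₂ (i , p))
      v∈T : v ∈ T
      v∈T = isYes⁺ (T? v) (inj₁ (isYes⁺ (v ≟ᶠ v) refl))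
      T⊆U : T ⊆ U
      T⊆U u p with isYes⁻ (T? u) p
      ... | inj₁ q = subst (_∈ U) (isYes⁻ (v ≟ᶠ u) q) v∈U
      ... | inj₂ (i , q) = proj₁ (proj₂ (arm i)) u q
      from-v : ∀ u → u ∈ T → Reach G T v u
      from-v u p with isYes⁻ (T? u) p
      ... | inj₁ q = subst (Reach G T v) (isYes⁻ (v ≟ᶠ u) q) (here v∈T)
      ... | inj₂ (i , q) = reach-mono G (Q⊆T i) (proj₁ (proj₂ (proj₂ (proj₂ (arm i)))) u q)
      T-conn : Connected G T
      T-conn u w p q = reach-trans G (reach-sym G (from-v u p)) (from-v w q)
      T-size : count T ≤ suc (n H * d)
      T-size = ≤-trans (count-union T ⟦ v ⟧ ⟪ (λ u → any? λ i → u ∈? Q i) ⟫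
                 (λ u p → [ inj₁ , (λ q → inj₂ (isYes⁺ (any? λ i → u ∈? Q i) q)) ]′ (isYes⁻ (T? u) p)))
               (+-mono-≤ (count-⟦⟧ v) (≤-trans
                 (count-cover ⟪ (λ u → any? λ i → u ∈? Q i) ⟫ Q (λ u → isYes⁻ (any? λ i → u ∈? Q i)))
                 (sumFin-bounded (count ∘ Q) d (λ i → proj₁ (proj₂ (proj₂ (arm i)))))))
      T-touch : ∀ j → z ≢ j → Live G U (M j) → Live G (U ∖ T) T → Touch G (M j) T
      T-touch j _ l _ = let x , x∈ , y , y∈ , xy = proj₂ (proj₂ (proj₂ (proj₂ (arm j)))) l
                        in (λ u p q → apart j u p (T⊆U u q)) , y , y∈ , x , Q⊆T j x x∈ , adj-sym G xy
      bd : ∀ u w → u ∈ U ∖ T → w ∈ P → w ∉ U ∖ T → w ∈ adj G u → w ∈ T ⊎ ∃ λ i → z ≢ i × w ∈ X i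
      bd u w u∈ w∈P w∉ uw with toSum (w ∈? U)
      ... | inj₁ w∈U = [ inj₁ , ⊥-elim ∘ w∉ ]′ (∖-split U T w∈U)
      ... | inj₂ w∉U with boundary u w (proj₁ (∖⁻ U T u∈)) w∈P w∉U uw
      -- A boundary vertex in the overwritten slot `z` would make that slot live.
      ...   | i , w∈X = inj₂ (i , (λ { refl → dead (u , proj₁ (∖⁻ U T u∈) , w , X⊆M i w w∈X , uw) }) , w∈X)

    -- The ball `B₁` becomes the branch set and leaves `U`. A vertex of `U` adjacent to the inner
    -- ball `B₀` already lies in `B₁`, so the rest of `U` sees only the outermost layer `L`, which
    -- `thin` bounds by `s`.
    grow-branch-set : ∀ i → Live G U (M i) → ∀ e →
                      count (Ball G U (M i) (suc e)) ≤ count (Ball G U (M i) e) + s →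
                      let U′ = U ∖ Ball G U (M i) (suc e) in State U′ × count U′ < count U
    grow-branch-set i l e thin =
        replace i U′ B₁ L (λ u p → proj₁ (∖⁻ U B₁ p)) (Ball-connected G U (M i) (conn i) (suc e))
          (λ u p q → proj₂ (∖⁻ U B₁ q) p) B-touch (λ u p → proj₁ (∖⁻ B₁ B₀ p)) L-size bd
      , shrink l
      where
      B₀ B₁ L U′ : VSet G
      B₀ = Ball G U (M i) e
      B₁ = Ball G U (M i) (suc e)
      L = B₁ ∖ B₀
      U′ = U ∖ B₁
      M⊆B₀ : M i ⊆ B₀
      M⊆B₀ = Ball-mono G U (M i) (≤⇒≤′ {0} {e} z≤n)
      L-size : count L ≤ s
      L-size = +-cancelˡ-≤ (count B₀) _ _ (≤-trans
        (count-disjoint B₀ L B₁ (Ball-step G U (M i) e) (λ u p → proj₁ (∖⁻ B₁ B₀ p)) (λ u p q → proj₂ (∖⁻ B₁ B₀ q) p))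
        thin)
      shrink : Live G U (M i) → count U′ < count U
      shrink (u , u∈U , w , w∈M , uw) = count-strict U′ U (λ x p → proj₁ (∖⁻ U B₁ p)) u
        (λ p → proj₂ (∖⁻ U B₁ p) (Ball-neighbour G U (M i) e u∈U (M⊆B₀ w w∈M) uw)) u∈U
      B-touch : ∀ j → i ≢ j → Live G U (M j) → Live G U′ B₁ → Touch G (M j) B₁
      B-touch j i≢j lj _ with touch j i (i≢j ∘ ≡.sym) lj l
      ... | dis , u , u∈ , v , v∈ , uv =
          (λ x p q → [ dis x p , apart j x p ]′ (Ball-⊆ G U (M i) (suc e) x q))
        , u , u∈ , v , Ball-step G U (M i) e v (M⊆B₀ v v∈) , uv
      bd : ∀ u w → u ∈ U′ → w ∈ P → w ∉ U′ → w ∈ adj G u → w ∈ L ⊎ ∃ λ j → i ≢ j × w ∈ X j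
      bd u w u∈ w∈P w∉ uw with toSum (w ∈? U)
      ... | inj₁ w∈U = inj₁ (∖⁺ B₁ B₀ ([ (λ a → a) , ⊥-elim ∘ w∉ ]′ (∖-split U B₁ w∈U))
                        (λ w∈B₀ → proj₂ (∖⁻ U B₁ u∈) (Ball-neighbour G U (M i) e (proj₁ (∖⁻ U B₁ u∈)) w∈B₀ uw)))
      ... | inj₂ w∉U with boundary u w (proj₁ (∖⁻ U B₁ u∈)) w∈P w∉U uw
      -- The old `X i` lies in `B₀`, hence has no neighbour left in `U′` and may be discarded.
      ...   | j , w∈X = inj₂ (j , (λ { refl → proj₂ (∖⁻ U B₁ u∈)
                (Ball-neighbour G U (M i) e (proj₁ (∖⁻ U B₁ u∈)) (M⊆B₀ w (X⊆M i w w∈X)) uw) }) , w∈X)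

    -- If some slot is dead and no vertex of `U` is within distance `d` of all live branch sets,
    -- then each vertex of `U` is missed by the `d`-ball of some live one. By averaging, one such
    -- ball misses at least a `1 / n H` fraction of `U`, and its branch set is grown.
    progress : suc (n H * d) ≤ s → count P < d * suc s → 0 < count U → MinorModel H G ⊎ Progress
    progress hd≤s few U≢∅ with all? (λ i → live? G U (M i))
    ... | yes live = inj₁ (model live)
    ... | no ¬live with ¬∀⟶∃¬ _ _ (λ i → live? G U (M i)) ¬live
    ...   | z , dead with any? (λ v → (v ∈? U) ×-dec all? (λ i → live? G U (M i) →-dec (v ∈? Ball G U (M i) d)))
    ...     | yes (v , v∈U , central) = inj₂ (add-branch-set hd≤s z dead v v∈U central)
    ...     | no none = inj₂ (U ∖ ball i , proj₁ grown , proj₂ grown ,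
                inj₁ (≤-trans U≤ (*-monoˡ-≤ (count (U ∖ ball i)) (n≤1+n (n H)))))
      where
      flat : ∀ i → ∃ λ e → e < d × count (Ball G U (M i) (suc e)) ≤ count (Ball G U (M i) e) + s
      -- A ball adds only vertices of `U ⊆ P` to `M i`, fewer than `d * suc s`, so a sparse layer
      -- occurs within radius `d`.
      flat i = flat-step (count ∘ Ball G U (M i)) d s (≤-<-trans
        (count-union (Ball G U (M i) d) (M i) U (Ball-⊆ G U (M i) d))
        (+-monoʳ-< (count (M i)) (≤-<-trans (count-mono U P U⊆P) few)))
      ball : Fin (n H) → VSet G
      ball i = Ball G U (M i) (suc (proj₁ (flat i)))
      -- Liveness is built in so that the slot chosen by averaging, whose `far` set is non-empty, is
      -- live.
      far? : ∀ i v → Dec (v ∈ U ∖ ball i × Live G U (M i))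
      far? i v = (v ∈? U ∖ ball i) ×-dec live? G U (M i)
      far : Fin (n H) → VSet G
      far i = ⟪ far? i ⟫
      U-covered : ∀ v → v ∈ U → ∃ λ i → v ∈ far i
      U-covered v v∈U with ¬∀⟶∃¬ _ _ (λ i → live? G U (M i) →-dec (v ∈? Ball G U (M i) d)) (λ c → none (v , v∈U , c))
      ... | i , ¬c with live? G U (M i)
      ...   | no ¬l = ⊥-elim (¬c (⊥-elim ∘ ¬l))
      ...   | yes l = i , isYes⁺ (far? i v) (∖⁺ U (ball i) v∈U
                (λ p → ¬c (λ _ → Ball-mono G U (M i) (≤⇒≤′ (proj₁ (proj₂ (flat i)))) v p)) , l)
      i : Fin (n H)
      i = proj₁ (sumFin-max z (count ∘ far))
      U≤far : count U ≤ n H * count (far i)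
      U≤far = ≤-trans (count-cover U far U-covered) (proj₂ (sumFin-max z (count ∘ far)))
      U≤ : count U ≤ n H * count (U ∖ ball i)
      U≤ = ≤-trans U≤far (*-monoʳ-≤ (n H) (count-mono (far i) (U ∖ ball i) (λ v p → proj₁ (isYes⁻ (far? i v) p))))
      far-nonempty : 0 < count (far i)
      far-nonempty = n≢0⇒n>0 λ eq → <⇒≱ U≢∅ (≤-trans U≤far (≤-reflexive (trans (cong (n H *_) eq) (*-zeroʳ (n H)))))
      live-i : Live G U (M i)
      live-i = let v , p = count-witness (far i) far-nonempty in proj₂ (isYes⁻ (far? i v) p)
      grown : State (U ∖ ball i) × count (U ∖ ball i) < count U
      grown = grow-branch-set i live-i (proj₁ (flat i)) (proj₂ (proj₂ (flat i)))

  -- Every step strictly shrinks `U`, so the bound `b` on its size drives the recursion. The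
  -- invariant `large` survives because `U` held more than half of `P` before the step and
  -- `Progress` limits the loss.
  search : suc (n H * d) ≤ s → count P < d * suc s → ∀ b {U} → State U → count U ≤ b →
           count P ≤ 2 * (suc (n H) * count U) + 2 * s → MinorModel H G ⊎ Separation
  search hd≤s few b {U} σ U≤b large with 2 * count U ≤? count P
  ... | yes half = inj₂ (separation σ half large)
  search hd≤s few zero {U} σ U≤b large | no ¬half =
    ⊥-elim (¬half (≤-trans (≤-reflexive (cong (2 *_) (n≤0⇒n≡0 U≤b))) z≤n))
  search hd≤s few (suc b) {U} σ U≤b large | no ¬half
    with progress σ hd≤s few (n≢0⇒n>0 λ eq → ¬half (≤-trans (≤-reflexive (cong (2 *_) eq)) z≤n))
  ... | inj₁ minor = inj₁ minor
  ... | inj₂ (U′ , σ′ , U′<U , gain) = search hd≤s few b σ′ (s≤s⁻¹ (≤-trans U′<U U≤b)) (large′ gain)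
    where
    open ≤-Reasoning
    P≤2U : count P ≤ 2 * count U
    P≤2U = <⇒≤ (≰⇒> ¬half)
    large′ : count U ≤ suc (n H) * count U′ ⊎ count U ≤ count U′ + s →
             count P ≤ 2 * (suc (n H) * count U′) + 2 * s
    large′ (inj₁ p) = ≤-trans P≤2U (≤-trans (*-monoʳ-≤ 2 p) (m≤m+n _ (2 * s)))
    large′ (inj₂ p) = begin
      count P                                   ≤⟨ P≤2U ⟩
      2 * count U                               ≤⟨ *-monoʳ-≤ 2 p ⟩
      2 * (count U′ + s)                        ≡⟨ *-distribˡ-+ 2 (count U′) s ⟩
      2 * count U′ + 2 * s                      ≤⟨ +-monoˡ-≤ (2 * s) (*-monoʳ-≤ 2 (m≤m+n (count U′) (n H * count U′))) ⟩
      2 * (suc (n H) * count U′) + 2 * s        ∎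

  separate : suc (n H * d) ≤ s → count P < d * suc s → MinorModel H G ⊎ Separation
  separate hd≤s few = search hd≤s few (count P) initial ≤-refl (begin
    count P                                  ≤⟨ m≤n*m (count P) (2 * suc (n H)) ⟩
    2 * suc (n H) * count P                  ≡⟨ *-assoc 2 (suc (n H)) (count P) ⟩
    2 * (suc (n H) * count P)                ≤⟨ m≤m+n _ (2 * s) ⟩
    2 * (suc (n H) * count P) + 2 * s        ∎)
    where open ≤-Reasoning

-- Recursion over scales

quart : ℕ → ℕ
quart m = (m * m) * (m * m)

m≤quart : ∀ m → m ≤ quart m
m≤quart zero = z≤n
m≤quart m@(suc _) = ≤-trans (m≤m*n m m) (m≤m*n (m * m) (m * m))

-- The lower binomial coefficients sum to 4 + 6 + 4 + 1 = 15, and each lower power of `m` is at most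
-- its cube.
quart-suc-≤ : ∀ m → 0 < m → quart (suc m) ≤ quart m + 15 * (m * m * m)
quart-suc-≤ m@(suc _) _ = begin
  quart (suc m)
    ≡⟨ expand m ⟩
  quart m + (4 * (m * m * m) + 6 * (m * m) + 4 * m + 1)
    ≤⟨ +-monoʳ-≤ (quart m) (+-mono-≤ (+-mono-≤ (+-monoʳ-≤ (4 * (m * m * m)) (*-monoʳ-≤ 6 m²≤)) (*-monoʳ-≤ 4 m≤)) 1≤) ⟩
  quart m + (4 * (m * m * m) + 6 * (m * m * m) + 4 * (m * m * m) + m * m * m)
    ≡⟨ cong (quart m +_) (collect (m * m * m)) ⟩
  quart m + 15 * (m * m * m) ∎
  where
  open ≤-Reasoning
  expand : ∀ a → (suc a * suc a) * (suc a * suc a) ≡ (a * a) * (a * a) + (4 * (a * a * a) + 6 * (a * a) + 4 * a + 1)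
  expand = solve-∀
  collect : ∀ a → 4 * a + 6 * a + 4 * a + a ≡ 15 * a
  collect = solve-∀
  m²≤ : m * m ≤ m * m * m
  m²≤ = m≤m*n (m * m) m
  m≤ : m ≤ m * m * m
  m≤ = ≤-trans (m≤m*n m m) m²≤
  1≤ : 1 ≤ m * m * m
  1≤ = ≤-trans (s≤s z≤n) m≤

suc≤2* : ∀ {m} → 0 < m → suc m ≤ 2 * m
suc≤2* {m} 0<m = ≤-trans (+-monoˡ-≤ m 0<m) (≤-reflexive (cong (m +_) (≡.sym (+-identityʳ m))))

module Scale (k m : ℕ) (0<k : 0 < k) (60k≤m : 60 * k ≤ m) where
  open ≤-Reasoning

  60≤m : 60 ≤ m
  60≤m = ≤-trans (*-monoʳ-≤ 60 0<k) 60k≤m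

  0<m : 0 < m
  0<m = ≤-trans (s≤s z≤n) 60≤m

  private instance
    k≢0 : NonZero k
    k≢0 = >-nonZero 0<k
    m≢0 : NonZero m
    m≢0 = >-nonZero 0<m

  -- For `|P| ≤ (m + 1)⁴ = d * d`, these values give both `|P| < d * suc s` and, with `k = n H + 1`,
  -- `1 + n H * d ≤ s`.
  d s : ℕ
  d = suc m * suc m
  s = k * d

  d≤4m² : d ≤ 4 * (m * m)
  d≤4m² = ≤-trans (*-mono-≤ (suc≤2* 0<m) (suc≤2* 0<m)) (≤-reflexive (eq m))
    where
    eq : ∀ a → (2 * a) * (2 * a) ≡ 4 * (a * a)
    eq = solve-∀

  60km³≤quart : 60 * k * (m * m * m) ≤ quart m
  60km³≤quart = ≤-trans (*-monoˡ-≤ (m * m * m) 60k≤m) (≤-reflexive (eq m))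
    where
    eq : ∀ a → a * (a * a * a) ≡ (a * a) * (a * a)
    eq = solve-∀

  4s≤quart : 4 * s ≤ quart m
  4s≤quart = begin
    4 * (k * d)                ≤⟨ *-monoʳ-≤ 4 (*-monoʳ-≤ k d≤4m²) ⟩
    4 * (k * (4 * (m * m)))    ≡⟨ eq k m ⟩
    16 * k * (m * m)           ≤⟨ *-mono-≤ (*-monoˡ-≤ k (m≤m+n 16 44)) (m≤m*n (m * m) m) ⟩
    60 * k * (m * m * m)       ≤⟨ 60km³≤quart ⟩
    quart m                    ∎
    where
    eq : ∀ b a → 4 * (b * (4 * (a * a))) ≡ 16 * b * (a * a)
    eq = solve-∀

  quart-suc≤2quart : quart (suc m) ≤ 2 * quart m
  quart-suc≤2quart = begin
    quart (suc m)                ≤⟨ quart-suc-≤ m 0<m ⟩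
    quart m + 15 * (m * m * m)   ≤⟨ +-monoʳ-≤ (quart m) (*-monoˡ-≤ (m * m * m) (≤-trans (m≤m+n 15 45) (m≤m*n 60 k))) ⟩
    quart m + 60 * k * (m * m * m) ≤⟨ +-monoʳ-≤ (quart m) 60km³≤quart ⟩
    quart m + quart m            ≡⟨ cong (quart m +_) (+-identityʳ (quart m)) ⟨
    2 * quart m                  ∎

  small-half : ∀ {a N} → 2 * a ≤ N → N ≤ quart (suc m) → a ≤ quart m
  small-half 2a≤N N≤ = *-cancelˡ-≤ 2 (≤-trans 2a≤N (≤-trans N≤ quart-suc≤2quart))

  -- As `4s ≤ m⁴ ≤ N`, the bound `large` gives `a ≥ N / 4k ≥ m⁴ / 4k`. By `m ≥ 60k` this is at least
  -- `15m³`, which bounds the gap between consecutive fourth powers, so removing `a` brings the rest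
  -- below `m⁴`.
  small-rest : ∀ {a b N} → a + b ≤ N → N ≤ 2 * (k * a) + 2 * s → quart m ≤ N → N ≤ quart (suc m) →
               b ≤ quart m
  small-rest {a} {b} {N} a+b≤N large lo hi =
    *-cancelˡ-≤ (4 * k) {{m*n≢0 4 k}} (+-cancelʳ-≤ (quart m) (4 * k * b) (4 * k * quart m) (begin
      4 * k * b + quart m                        ≤⟨ +-monoʳ-≤ (4 * k * b) (≤-trans lo N≤4ka) ⟩
      4 * k * b + 4 * k * a                      ≡⟨ *-distribˡ-+ (4 * k) b a ⟨
      4 * k * (b + a)                            ≤⟨ *-monoʳ-≤ (4 * k) (≤-trans (≤-reflexive (+-comm b a)) a+b≤N) ⟩
      4 * k * N                                  ≤⟨ *-monoʳ-≤ (4 * k) (≤-trans hi (quart-suc-≤ m 0<m)) ⟩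
      4 * k * (quart m + 15 * (m * m * m))       ≡⟨ eq k (quart m) (m * m * m) ⟩
      4 * k * quart m + 60 * k * (m * m * m)     ≤⟨ +-monoʳ-≤ (4 * k * quart m) 60km³≤quart ⟩
      4 * k * quart m + quart m                  ∎))
    where
    eq : ∀ x y z → 4 * x * (y + 15 * z) ≡ 4 * x * y + 60 * x * z
    eq = solve-∀
    eq′ : ∀ x y z → 2 * (2 * (x * y) + 2 * z) ≡ 4 * x * y + 4 * z
    eq′ = solve-∀
    N≤4ka : N ≤ 4 * k * a
    N≤4ka = +-cancelʳ-≤ N N (4 * k * a) (begin
      N + N                          ≡⟨ cong (N +_) (+-identityʳ N) ⟨
      2 * N                          ≤⟨ *-monoʳ-≤ 2 large ⟩
      2 * (2 * (k * a) + 2 * s)      ≡⟨ eq′ k a s ⟩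
      4 * k * a + 4 * s              ≤⟨ +-monoʳ-≤ (4 * k * a) (≤-trans 4s≤quart lo) ⟩
      4 * k * a + N                  ∎)

  -- The separator has at most `4k²m²` vertices and `m (m + 1) ≤ 2m²`; this is where `c = 8k²` comes
  -- from.
  boundary-cost : ∀ {h} → h ≤ k → m * suc m * (h * s) ≤ 8 * (k * k) * quart m
  boundary-cost {h} h≤k = begin
    m * suc m * (h * s)                           ≤⟨ *-monoʳ-≤ (m * suc m) (*-monoˡ-≤ s h≤k) ⟩
    m * suc m * (k * (k * d))                     ≤⟨ *-mono-≤ (*-monoʳ-≤ m (suc≤2* 0<m)) (*-monoʳ-≤ k (*-monoʳ-≤ k d≤4m²)) ⟩
    m * (2 * m) * (k * (k * (4 * (m * m))))       ≡⟨ eq m k ⟩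
    8 * (k * k) * quart m                         ∎
    where
    eq : ∀ a b → a * (2 * a) * (b * (b * (4 * (a * a)))) ≡ 8 * (b * b) * ((a * a) * (a * a))
    eq = solve-∀

-- The deficiency budget at scale m = J + i is c (1/J − 1/m) per vertex; the separator of a set between
-- scales m and m + 1 costs at most c (1/m − 1/(m + 1)) per vertex.
budget-step : ∀ c J i {a b N T T′ x} → 0 < J → let m = J + i in
              J * m * T ≤ c * i * a → J * m * T′ ≤ c * i * b → m * suc m * x ≤ c * N → a + b ≤ N →
              J * suc m * (T + T′ + x) ≤ c * suc i * N
budget-step c J i {a} {b} {N} {T} {T′} {x} 0<J pa pb px a+b≤N =
  *-cancelˡ-≤ m {{>-nonZero (≤-trans 0<J (m≤m+n J i))}} (begin
    m * (J * suc m * (T + T′ + x))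
      ≡⟨ eq₁ m J T T′ x ⟩
    suc m * (J * m * T + J * m * T′) + J * (m * suc m * x)
      ≤⟨ +-mono-≤ (*-monoʳ-≤ (suc m) (+-mono-≤ pa pb)) (*-monoʳ-≤ J px) ⟩
    suc m * (c * i * a + c * i * b) + J * (c * N)
      ≡⟨ cong (λ y → suc m * y + J * (c * N)) (*-distribˡ-+ (c * i) a b) ⟨
    suc m * (c * i * (a + b)) + J * (c * N)
      ≤⟨ +-monoˡ-≤ (J * (c * N)) (*-monoʳ-≤ (suc m) (*-monoʳ-≤ (c * i) a+b≤N)) ⟩
    suc m * (c * i * N) + J * (c * N)
      -- With `m = J + i`, the identity is `(m + 1) i + J = m (i + 1)`, the telescoping of the
      -- budgets.
      ≡⟨ eq₂ c J i N ⟩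
    m * (c * suc i * N) ∎)
  where
  open ≤-Reasoning
  m = J + i
  eq₁ : ∀ m J T T′ x → m * (J * suc m * (T + T′ + x)) ≡ suc m * (J * m * T + J * m * T′) + J * (m * suc m * x)
  eq₁ = solve-∀
  eq₂ : ∀ c J i N → suc (J + i) * (c * i * N) + J * (c * N) ≡ (J + i) * (c * suc i * N)
  eq₂ = solve-∀

module _ (H G : Graph) (minor-free : ¬ IsMinor H G) (t J : ℕ) (60k≤J : 60 * suc (n H) ≤ J) where

  private
    k c : ℕ
    k = suc (n H)
    c = 8 * (k * k)

  0<J : 0 < J
  0<J = ≤-trans (s≤s z≤n) 60k≤J

  -- `T` counts the separator vertices given up so far. `budget` is `T ≤ c (1/J − 1/(J + i)) |P|`
  -- with denominators cleared.
  record NearlyTight (i : ℕ) (P : VSet G) : Set where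
    constructor tight
    field
      T      : ℕ
      dense  : t * count P ≤ edgesAt G P + t * T
      budget : J * (J + i) * T ≤ c * i * count P

  record Split (m : ℕ) (P : VSet G) : Set where
    field
      A B     : VSet G
      x       : ℕ
      A⊆P     : A ⊆ P
      B⊆P     : B ⊆ P
      disj    : ∀ v → v ∈ A → v ∉ B
      nonadj  : ∀ u v → u ∈ A → v ∈ B → v ∉ adj G u
      cover   : count P ≤ (count A + count B) + x
      A-small : count A ≤ quart m
      B-small : count B ≤ quart m
      cost    : m * suc m * x ≤ c * count P

  -- A set that already fits scale `m` is split trivially, with `B` empty and at no cost, so that
  -- the recursion always descends exactly one scale.
  split : ∀ m → J ≤ m → ∀ P → count P ≤ quart (suc m) → Split m P
  split m J≤m P P≤ with count P ≤? quart m
  ... | yes small = record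
    { A = P ; B = λ _ → false ; x = 0 ; A⊆P = λ v p → p ; B⊆P = λ { v () }
    ; disj = λ { v _ () } ; nonadj = λ { u v _ () }
    ; cover = ≤-trans (m≤m+n (count P) (count {n G} (λ _ → false))) (≤-reflexive (≡.sym (+-identityʳ _)))
    ; A-small = small
    ; B-small = ≤-trans (≤-reflexive (count-∅ (n G))) z≤n
    ; cost = ≤-trans (≤-reflexive (*-zeroʳ (m * suc m))) z≤n
    }
  ... | no big = from-separation (separate H G P s d hd≤s few)
    where
    open Scale k m (s≤s z≤n) (≤-trans 60k≤J J≤m)
    hd≤s : suc (n H * d) ≤ s
    hd≤s = +-monoˡ-≤ (n H * d) (s≤s z≤n)
    few : count P < d * suc s
    few = ≤-<-trans P≤ (*-monoʳ-< d (s≤s (m≤m+n d (n H * d))))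
    from-separation : MinorModel H G ⊎ Separation H G P s d → Split m P
    from-separation (inj₁ minor) = ⊥-elim (minor-free minor)
    from-separation (inj₂ sep) = record
      { A = A ; B = B ; x = n H * s ; A⊆P = A⊆P ; B⊆P = B⊆P ; disj = disj ; nonadj = nonadj ; cover = cover
      ; A-small = small-half half P≤
      ; B-small = small-rest (count-disjoint A B P A⊆P B⊆P disj) large (<⇒≤ (≰⇒> big)) P≤
      -- In this case `m⁴ ≤ |P|`, which turns the absolute bound into a cost per vertex.
      ; cost = ≤-trans (boundary-cost (n≤1+n (n H))) (*-monoʳ-≤ c (<⇒≤ (≰⇒> big)))
      }
      where open Separation sep

  join : ∀ i {P} (σ : Split (J + i) P) → NearlyTight i (Split.A σ) → NearlyTight i (Split.B σ) →
         NearlyTight (suc i) P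
  join i {P} σ (tight Tᴬ denseᴬ budgetᴬ) (tight Tᴮ denseᴮ budgetᴮ) = tight (Tᴬ + Tᴮ + x) dense budget
    where
    open Split σ
    open ≤-Reasoning
    eq : ∀ e e′ t T T′ x → (e + t * T) + (e′ + t * T′) + t * x ≡ (e + e′) + t * (T + T′ + x)
    eq = solve-∀
    dense : t * count P ≤ edgesAt G P + t * (Tᴬ + Tᴮ + x)
    dense = begin
      t * count P                                ≤⟨ *-monoʳ-≤ t cover ⟩
      t * (count A + count B + x)                ≡⟨ *-distribˡ-+ t (count A + count B) x ⟩
      t * (count A + count B) + t * x            ≡⟨ cong (_+ t * x) (*-distribˡ-+ t (count A) (count B)) ⟩
      t * count A + t * count B + t * x          ≤⟨ +-monoˡ-≤ (t * x) (+-mono-≤ denseᴬ denseᴮ) ⟩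
      (edgesAt G A + t * Tᴬ) + (edgesAt G B + t * Tᴮ) + t * x
        ≡⟨ eq (edgesAt G A) (edgesAt G B) t Tᴬ Tᴮ x ⟩
      (edgesAt G A + edgesAt G B) + t * (Tᴬ + Tᴮ + x)
        ≤⟨ +-monoˡ-≤ (t * (Tᴬ + Tᴮ + x)) (edgesAt-disjoint G A B P A⊆P B⊆P disj nonadj) ⟩
      edgesAt G P + t * (Tᴬ + Tᴮ + x)            ∎
    budget : J * (J + suc i) * (Tᴬ + Tᴮ + x) ≤ c * suc i * count P
    budget = subst (λ m → J * m * (Tᴬ + Tᴮ + x) ≤ c * suc i * count P) (≡.sym (+-suc J i))
      (budget-step c J i 0<J budgetᴬ budgetᴮ cost (count-disjoint A B P A⊆P B⊆P disj))

  -- At the lowest scale sets have size at most `J⁴`, the island bound, so without an island there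
  -- is no loss at all; each higher scale adds the loss of one separator.
  island-or-tight : ∀ i P → count P ≤ quart (J + i) → SmallIsland G t (quart J) ⊎ NearlyTight i P
  island-or-tight zero P P≤ with island-or-edges G t (quart J) (quart J) P
                                   (subst (λ m → count P ≤ quart m) (+-identityʳ J) P≤) ≤-refl
  ... | inj₁ island = inj₁ island
  ... | inj₂ dense = inj₂ (tight 0 (≤-trans dense (m≤m+n _ (t * 0)))
                             (≤-trans (≤-reflexive (*-zeroʳ (J * (J + 0)))) z≤n))
  island-or-tight (suc i) P P≤ = both (split (J + i) (m≤m+n J i) P (subst (λ m → count P ≤ quart m) (+-suc J i) P≤))
    where
    both : Split (J + i) P → SmallIsland G t (quart J) ⊎ NearlyTight (suc i) P
    both σ with island-or-tight i (Split.A σ) (Split.A-small σ) | island-or-tight i (Split.B σ) (Split.B-small σ)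
    ... | inj₁ island | _ = inj₁ island
    ... | inj₂ _ | inj₁ island = inj₁ island
    ... | inj₂ a | inj₂ b = inj₂ (join i σ a b)

-- Choice of the constants and conclusion

count-full : ∀ m → count {m} (λ _ → true) ≡ m
count-full zero = refl
count-full (suc m) = cong suc (count-full m)

-- Here `α = p / q`, and the edge bound is multiplied by `q`. A real `α` reduces to this by passing
-- to a smaller positive rational, which only weakens the edge bound.
theorem11 : (H : Graph) (t : ℕ) → 1 ≤ t → (p q : ℕ) → 0 < p → 0 < q →
    Σ ℕ λ C → 0 < C ×
    ((G : Graph) → ¬ IsMinor H G →
    q * numEdges G + p * numVertices G < t * q * numVertices G →
    Σ (VSet G) λ S → IsIsland t G S × count S ≤ C)
theorem11 H t 1≤t p q 0<p 0<q = quart J , ≤-trans 0<J′ (m≤quart J) , island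
  where
  open ≤-Reasoning
  k c J : ℕ
  k = suc (n H)
  c = 8 * (k * k)
  -- The factor `c * (t * q)` makes `T ≤ cN / J` give `tqT ≤ N`; the factor `60 * k` satisfies the
  -- size condition on the scales.
  J = c * (t * q) * (60 * k)
  0<ctq : 0 < c * (t * q)
  0<ctq = *-mono-≤ {1} {c} (s≤s z≤n) (*-mono-≤ 1≤t 0<q)
  60k≤J : 60 * k ≤ J
  60k≤J = m≤n*m (60 * k) (c * (t * q)) {{>-nonZero 0<ctq}}
  0<J′ : 0 < J
  0<J′ = ≤-trans (s≤s z≤n) 60k≤J
  island : (G : Graph) → ¬ IsMinor H G →
           q * numEdges G + p * numVertices G < t * q * numVertices G →
           Σ (VSet G) λ S → IsIsland t G S × count S ≤ quart J
  island G minor-free sparse with island-or-tight H G minor-free t J 60k≤J (n G) (λ _ → true)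
       -- Scale `J + n G` is large enough for the whole vertex set, because `n G ≤ (J + n G)⁴`.
       (≤-trans (≤-reflexive (count-full (n G))) (≤-trans (m≤n+m (n G) J) (m≤quart (J + n G))))
  ... | inj₁ small = small
  ... | inj₂ (tight T dense budget) = ⊥-elim (<-irrefl refl (begin-strict
    q * E + p * N        <⟨ sparse ⟩
    t * q * N            ≡⟨ eq₁ t q N ⟩
    q * (t * N)          ≤⟨ *-monoʳ-≤ q dense′ ⟩
    q * (E + t * T)      ≡⟨ eq₂ q E t T ⟩
    q * E + t * q * T    ≤⟨ +-monoʳ-≤ (q * E) tqT≤N ⟩
    -- The loss `tT` is at most `N / q`, and `p ≥ 1` puts this below `αN`.
    q * E + N            ≤⟨ +-monoʳ-≤ (q * E) (m≤n*m N p {{>-nonZero 0<p}}) ⟩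
    q * E + p * N        ∎))
    where
    N = n G
    E = numEdges G
    eq₁ : ∀ t q N → t * q * N ≡ q * (t * N)
    eq₁ = solve-∀
    eq₂ : ∀ q E t T → q * (E + t * T) ≡ q * E + t * q * T
    eq₂ = solve-∀
    eq₃ : ∀ J m T → m * (J * T) ≡ J * m * T
    eq₃ = solve-∀
    eq₄ : ∀ c m N → c * m * N ≡ m * (c * N)
    eq₄ = solve-∀
    dense′ : t * N ≤ E + t * T
    dense′ = subst (λ y → t * y ≤ E + t * T) (count-full N)
      (≤-trans dense (+-monoˡ-≤ (t * T) (edgesAt≤numEdges G (λ _ → true))))
    -- The total loss over all scales is bounded independently of their number, since
    -- `N / (J + N) ≤ 1`.
    JT≤cN : J * T ≤ c * N
    JT≤cN = *-cancelˡ-≤ (J + N) {{>-nonZero (≤-trans 0<J′ (m≤m+n J N))}} (begin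
      (J + N) * (J * T)                    ≡⟨ eq₃ J (J + N) T ⟩
      J * (J + N) * T                      ≤⟨ budget ⟩
      c * N * count {N} (λ _ → true)       ≡⟨ cong (c * N *_) (count-full N) ⟩
      c * N * N                            ≤⟨ *-monoˡ-≤ N (*-monoʳ-≤ c (m≤n+m N J)) ⟩
      c * (J + N) * N                      ≡⟨ eq₄ c (J + N) N ⟩
      (J + N) * (c * N)                    ∎)
    tqT≤N : t * q * T ≤ N
    tqT≤N = *-cancelˡ-≤ c (begin
      c * (t * q * T)                      ≡⟨ *-assoc c (t * q) T ⟨
      c * (t * q) * T                      ≤⟨ *-monoˡ-≤ T (m≤m*n (c * (t * q)) (60 * k)) ⟩
      J * T                                ≤⟨ JT≤cN ⟩
      c * N                                ∎)
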